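{- (a) There exist infinitely many graphs $G$ with $strc(G)=src(G)=3$. (b) For every integer $s\ge 13$, there exists a graph $G$ with $strc(G)=srvc(G)=s$. (c) For all integers $1\le t<s$, there exists a graph $G$ with $strc(G)\ge s$ and $srvc(G)=t$.
   Context: All graphs are finite, simple and connected; $u$–$v$ geodesic means a $u$–$v$ path of length $d(u,v)$. $src(G)$ is the minimum number of colours in an edge-colouring of $G$ in which any two vertices are joined by a geodesic whose edges have distinct colours. $srvc(G)$ is the minimum number of colours in a vertex-colouring in which any two vertices are joined by a geodesic whose internal vertices have distinct colours (value $0$ for complete graphs). $strc(G)$ is the minimum number of colours in a total-colouring (vertices and edges) in which any two vertices are joined by a geodesic whose edges and internal vertices all have pairwise distinct colours. -}

module Defs where

open import Data.Nat using (ℕ; zero; suc; _≤_; _<_)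
open import Data.Fin using (Fin)
open import Data.Bool using (Bool; true; false; T)
open import Data.List using (List; []; _∷_; _++_)
open import Data.List.Relation.Unary.Unique.Propositional using (Unique)
open import Data.Product using (Σ; ∃; ∃-syntax; _×_; _,_)
open import Data.Sum using (_⊎_)
open import Relation.Nullary using (¬_)
open import Relation.Binary.PropositionalEquality using (_≡_; _≢_; subst)

record SimpleGraph : Set where
  field
    n        : ℕ
    nonempty : 1 ≤ n
    adj      : Fin n → Fin n → Bool
    adj-sym  : ∀ u v → adj u v ≡ adj v u
    adj-irr  : ∀ u → adj u u ≡ false

open SimpleGraph public

Adj : (G : SimpleGraph) → Fin (n G) → Fin (n G) → Set
Adj G u v = T (adj G u v)

Adj-sym : (G : SimpleGraph) {u v : Fin (n G)} → Adj G u v → Adj G v u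
Adj-sym G {u} {v} p = subst T (adj-sym G u v) p

data Walk (G : SimpleGraph) : Fin (n G) → Fin (n G) → ℕ → Set where
  here : ∀ {u} → Walk G u u 0
  step : ∀ {u w v l} → Adj G u w → Walk G w v l → Walk G u v (suc l)

Connected : SimpleGraph → Set
Connected G = ∀ u v → ∃[ l ] Walk G u v l

IsGeodesic : (G : SimpleGraph) {u v : Fin (n G)} {l : ℕ} → Walk G u v l → Set
IsGeodesic G {u} {v} {l} _ = ∀ l' → Walk G u v l' → l ≤ l'

Complete : SimpleGraph → Set
Complete G = ∀ u v → u ≢ v → Adj G u v

record EdgeColouring (G : SimpleGraph) (k : ℕ) : Set where
  field
    col     : ∀ u v → Adj G u v → Fin k
    col-sym : ∀ u v (p : Adj G u v) → col u v p ≡ col v u (Adj-sym G p)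

open EdgeColouring public

edgeColours : {G : SimpleGraph} {k : ℕ} → EdgeColouring G k →
              ∀ {u v l} → Walk G u v l → List (Fin k)
edgeColours c here = []
edgeColours c (step {u} {w} p r) = col c u w p ∷ edgeColours c r

internal : {G : SimpleGraph} → ∀ {u v l} → Walk G u v l → List (Fin (n G))
internal here = []
internal (step p here) = []
internal (step {w = w} p (step q r)) = w ∷ internal (step q r)

vertexColours : {G : SimpleGraph} {k : ℕ} → (Fin (n G) → Fin k) →
                ∀ {u v l} → Walk G u v l → List (Fin k)
vertexColours f w = Data.List.map f (internal w)
  where import Data.List

IsStrongRainbow : (G : SimpleGraph) {k : ℕ} → EdgeColouring G k → Set
IsStrongRainbow G c = ∀ u v → ∃[ l ] Σ (Walk G u v l) λ P →
  IsGeodesic G P × Unique (edgeColours c P)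

IsStrongRainbowVertex : (G : SimpleGraph) {k : ℕ} → (Fin (n G) → Fin k) → Set
IsStrongRainbowVertex G f = ∀ u v → ∃[ l ] Σ (Walk G u v l) λ P →
  IsGeodesic G P × Unique (vertexColours f P)

IsStrongTotalRainbow : (G : SimpleGraph) {k : ℕ} →
  (Fin (n G) → Fin k) → EdgeColouring G k → Set
IsStrongTotalRainbow G f c = ∀ u v → ∃[ l ] Σ (Walk G u v l) λ P →
  IsGeodesic G P × Unique (edgeColours c P ++ vertexColours f P)

HasSRC : SimpleGraph → ℕ → Set
HasSRC G k = Σ (EdgeColouring G k) (IsStrongRainbow G)

HasSRVC : SimpleGraph → ℕ → Set
HasSRVC G k = Σ (Fin (n G) → Fin k) (IsStrongRainbowVertex G)

HasSTRC : SimpleGraph → ℕ → Set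
HasSTRC G k = Σ (Fin (n G) → Fin k) λ f → Σ (EdgeColouring G k) λ c →
  IsStrongTotalRainbow G f c

IsMin : (ℕ → Set) → ℕ → Set
IsMin P k = P k × (∀ j → j < k → ¬ P j)

Src : SimpleGraph → ℕ → Set
Src G k = IsMin (HasSRC G) k

-- convention: srvc(G) = 0 for complete graphs
Srvc : SimpleGraph → ℕ → Set
Srvc G k = (Complete G × k ≡ 0) ⊎ (¬ Complete G × IsMin (HasSRVC G) k)

Strc : SimpleGraph → ℕ → Set
Strc G k = IsMin (HasSTRC G) k

{-# OPTIONS --safe #-}
module Submission where

-- (a) In the pentagon with one vertex blown up into a clique, consecutive edges
-- lie on a unique geodesic, except at the blown-up vertex, where some clique
-- vertex works.  Two edge colours would thus have to alternate around a closed
-- walk of length five.  Three colours suffice for edges and vertices together.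
--
-- (b) Core vertices 1, …, s form a clique.  For each index p = (i , j , k), a rim
-- vertex of side 0 hangs on i and one of side 1 on j; their only geodesic is
-- rim – i – j – rim when i ≠ j, so core colours are distinct and srvc ≥ s.  Link
-- and apex vertices join all other pairs of rim vertices by geodesics avoiding the
-- core, which lets 13 colours serve all edges and the remaining vertices.
--
-- (c) In a spider every two edges or cut vertices lie on a common geodesic, so
-- strc counts edges and cut vertices, while srvc counts the cut vertices.

open import Defs
open import Data.Bool using (Bool; false; true)
open import Data.Bool.Properties using (T-irrelevant)
open import Data.Empty using (⊥-elim)
open import Data.Fin using (#_; Fin; _↑ˡ_; _≟_; inject≤; suc; zero)
open import Data.Fin.Patterns
open import Data.Fin.Properties using (*↔×; +↔⊎; all?; any?; injective⇒≤; pigeonhole; toℕ<n; ↑ˡ-injective)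
open import Data.List using (List; []; _++_; _∷_; _∷ʳ_; map; reverse)
open import Data.List.Membership.Propositional using (_∈_)
open import Data.List.Membership.Propositional.Properties using (∈-++⁺ʳ; ∈-++⁺ˡ; ∈-map⁺)
open import Data.List.Properties using (map-++; map-cong; map-∘; unfold-reverse)
open import Data.List.Relation.Binary.Permutation.Propositional using (↭-sym; ↭⇒↭ₛ)
import Data.List.Relation.Binary.Permutation.Propositional.Properties as ↭
open import Data.List.Relation.Binary.Permutation.Setoid.Properties using (Unique-resp-↭)
open import Data.List.Relation.Unary.All as All using ([]; _∷_)
import Data.List.Relation.Unary.All.Properties as AllP
open import Data.List.Relation.Unary.AllPairs using ([]; _∷_)
open import Data.List.Relation.Unary.Any using (here; there)
import Data.List.Relation.Unary.Unique.DecPropositional as DecUnique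
open import Data.List.Relation.Unary.Unique.Propositional using (Unique)
open import Data.List.Relation.Unary.Unique.Propositional.Properties using (map⁺; map⁻)
open import Data.Nat using (_*_; _+_; _<_; _∸_; _≤_; suc; s≤s; zero; z≤n; ℕ)
open import Data.Nat.Properties using (<⇒≱; m+[n∸m]≡n; m≤m+n; m≤n+m; ≤-trans)
open import Data.Product using (_,_; _×_; proj₁; proj₂; swap; Σ; ∃-syntax)
open import Data.Product.Function.NonDependent.Propositional using (_×-↔_)
import Data.Product.Properties as ×
open import Data.Sum using (_⊎_; inj₁; inj₂)
open import Data.Sum.Function.Propositional using (_⊎-↔_)
open import Data.Sum.Properties using (≡-dec)
open import Data.Vec using ([]; _∷_; lookup)
open import Function using (Inverse; _↔_; _∘_; id)
open import Function.Bundles using (Injection; mk⇔)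
open import Function.Construct.Composition using (_↔-∘_)
open import Function.Construct.Identity using (↔-id)
open import Function.Construct.Symmetry using (↔-sym)
open import Function.Properties.Inverse using (↔⇒↣)
open import Relation.Binary.Definitions using (DecidableEquality)
open import Relation.Binary.PropositionalEquality
open import Relation.Nullary using (Dec; contradiction; does; no; yes; ¬_; ⌊_⌋)
open import Relation.Nullary.Decidable using
  (_×-dec_; _→-dec_; _⊎-dec_; dec-false; dec-true; decidable-stable; does-⇔; from-yes; fromWitness; isYes≗does; map′; toWitness; ¬?)

private variable
  A C D V : Set

-- Repetition-free lists, finite codings, and comparison of the three colourings.

Unique-++⁻ˡ : ∀ (xs {ys} : List C) → Unique (xs ++ ys) → Unique xs
Unique-++⁻ˡ []       _        = []
Unique-++⁻ˡ (x ∷ xs) (x∉ ∷ u) = AllP.++⁻ˡ xs x∉ ∷ Unique-++⁻ˡ xs u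

Unique-++⁻ʳ : ∀ (xs {ys} : List C) → Unique (xs ++ ys) → Unique ys
Unique-++⁻ʳ []       u       = u
Unique-++⁻ʳ (x ∷ xs) (_ ∷ u) = Unique-++⁻ʳ xs u

-- Turns one rainbow geodesic into injectivity of the colouring on the objects along it.
Unique-map⇒injective : ∀ {f : C → D} {xs} → Unique (map f xs) →
                       ∀ {x y} → x ∈ xs → y ∈ xs → f x ≡ f y → x ≡ y
Unique-map⇒injective         (x∉ ∷ _) (here refl) (here refl) eq = refl
Unique-map⇒injective {f = f} (x∉ ∷ _) (here refl) (there y∈)  eq = contradiction eq (All.lookup x∉ (∈-map⁺ f y∈))
Unique-map⇒injective {f = f} (y∉ ∷ _) (there x∈)  (here refl) eq = contradiction (sym eq) (All.lookup y∉ (∈-map⁺ f x∈))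
Unique-map⇒injective         (_ ∷ u)  (there x∈)  (there y∈)  eq = Unique-map⇒injective u x∈ y∈ eq

⊎-code : ∀ {m n} → A ↔ Fin m → C ↔ Fin n → (A ⊎ C) ↔ Fin (m + n)
⊎-code i j = ↔-sym +↔⊎ ↔-∘ (i ⊎-↔ j)

×-code : ∀ {m n} → A ↔ Fin m → C ↔ Fin n → (A × C) ↔ Fin (m * n)
×-code i j = ↔-sym *↔× ↔-∘ (i ×-↔ j)

-- The colour list of a total-rainbow geodesic has its edge colours as a prefix and its vertex
-- colours as a suffix. Hence any lower bound for src or srvc is one for strc.
strc⇒src : ∀ {G k} → HasSTRC G k → HasSRC G k
strc⇒src (f , c , rb) = c , λ u v →
  let (l , P , geo , uniq) = rb u v in l , P , geo , Unique-++⁻ˡ (edgeColours c P) uniq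

strc⇒srvc : ∀ {G k} → HasSTRC G k → HasSRVC G k
strc⇒srvc (f , c , rb) = f , λ u v →
  let (l , P , geo , uniq) = rb u v in l , P , geo , Unique-++⁻ʳ (edgeColours c P) uniq

strc⇒connected : ∀ {G k} → HasSTRC G k → Connected G
strc⇒connected (_ , _ , rb) u v = proj₁ (rb u v) , proj₁ (proj₂ (rb u v))

-- Paths along a relation, their colours and their reversal.

infixr 5 _▹_

data Path {V : Set} (R : V → V → Set) : V → V → ℕ → Set where
  stop : ∀ {a} → Path R a a 0
  _▹_  : ∀ {a b c l} → R a b → Path R b c l → Path R a c (suc l)

module Paths {V : Set} (R : V → V → Set) where

  -- `ce` takes the edge proof because colourings pulled back from a graph are only given on
  -- adjacent pairs.
  edges : (∀ {a b} → R a b → C) → ∀ {a b l} → Path R a b l → List C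
  edges ce stop    = []
  edges ce (r ▹ p) = ce r ∷ edges ce p

  inner : ∀ {a b l} → Path R a b l → List V
  inner stop                            = []
  inner (r ▹ stop)                      = []
  inner (_▹_ {b = b} r p@(_ ▹ _)) = b ∷ inner p

  colours : (∀ {a b} → R a b → C) → (V → C) → ∀ {a b l} → Path R a b l → List C
  colours ce cv p = edges ce p ++ map cv (inner p)

  Shortest : ∀ {a b l} → Path R a b l → Set
  Shortest {a} {b} {l} _ = ∀ {l'} → Path R a b l' → l ≤ l'

  Rainbow : (∀ {a b l} → Path R a b l → List C) → V → V → Set
  Rainbow F a b = ∃[ l ] Σ (Path R a b l) λ p → Shortest p × Unique (F p)

  edges-map : ∀ (g : C → D) (ce : ∀ {a b} → R a b → C) {a b l} (p : Path R a b l) →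
              edges (g ∘ ce) p ≡ map g (edges ce p)
  edges-map g ce stop    = refl
  edges-map g ce (r ▹ p) = cong (g (ce r) ∷_) (edges-map g ce p)

  colours-map : ∀ (g : C → D) (ce : ∀ {a b} → R a b → C) (cv : V → C) {a b l} (p : Path R a b l) →
                colours (g ∘ ce) (g ∘ cv) p ≡ map g (colours ce cv p)
  colours-map g ce cv p = begin
    edges (g ∘ ce) p ++ map (g ∘ cv) (inner p)       ≡⟨ cong₂ _++_ (edges-map g ce p) (map-∘ (inner p)) ⟩
    map g (edges ce p) ++ map g (map cv (inner p))   ≡⟨ map-++ g (edges ce p) _ ⟨
    map g (colours ce cv p)                          ∎
    where open ≡-Reasoning

  module Reversal (R-sym : ∀ {a b} → R a b → R b a) where

    infixl 5 _◃_

    _◃_ : ∀ {a b c l} → Path R a b l → R b c → Path R a c (suc l)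
    stop    ◃ r = r ▹ stop
    (q ▹ p) ◃ r = q ▹ (p ◃ r)

    rev : ∀ {a b l} → Path R a b l → Path R b a l
    rev stop    = stop
    rev (r ▹ p) = rev p ◃ R-sym r

    edges-◃ : (ce : ∀ {a b} → R a b → C) → ∀ {a b c l} (p : Path R a b l) (r : R b c) →
              edges ce (p ◃ r) ≡ edges ce p ∷ʳ ce r
    edges-◃ ce stop    r = refl
    edges-◃ ce (q ▹ p) r = cong (ce q ∷_) (edges-◃ ce p r)

    -- The end of a path becomes internal only once a further edge is appended, hence the two
    -- appended edges.
    inner-◃ : ∀ {a b c d l} (p : Path R a b l) (r : R b c) (s : R c d) →
              inner (p ◃ r ◃ s) ≡ inner (p ◃ r) ∷ʳ c
    inner-◃ stop            r s = refl
    inner-◃ (q ▹ stop)      r s = refl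
    inner-◃ (q ▹ q' ▹ p)    r s = cong (_ ∷_) (inner-◃ (q' ▹ p) r s)

    edges-rev : (ce : ∀ {a b} → R a b → C) → (∀ {a b} (r : R a b) → ce (R-sym r) ≡ ce r) →
                ∀ {a b l} (p : Path R a b l) → edges ce (rev p) ≡ reverse (edges ce p)
    edges-rev ce ce-sym stop    = refl
    edges-rev ce ce-sym (r ▹ p) = begin
      edges ce (rev p ◃ R-sym r)            ≡⟨ edges-◃ ce (rev p) (R-sym r) ⟩
      edges ce (rev p) ∷ʳ ce (R-sym r)      ≡⟨ cong₂ _∷ʳ_ (edges-rev ce ce-sym p) (ce-sym r) ⟩
      reverse (edges ce p) ∷ʳ ce r          ≡⟨ unfold-reverse (ce r) (edges ce p) ⟨
      reverse (ce r ∷ edges ce p)           ∎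
      where open ≡-Reasoning

    inner-rev : ∀ {a b l} (p : Path R a b l) → inner (rev p) ≡ reverse (inner p)
    inner-rev stop             = refl
    inner-rev (r ▹ stop)       = refl
    inner-rev (_▹_ {b = b} r p@(q ▹ p')) = begin
      inner (rev p' ◃ R-sym q ◃ R-sym r)    ≡⟨ inner-◃ (rev p') (R-sym q) (R-sym r) ⟩
      inner (rev p) ∷ʳ b                    ≡⟨ cong (_∷ʳ b) (inner-rev p) ⟩
      reverse (inner p) ∷ʳ b                ≡⟨ unfold-reverse b (inner p) ⟨
      reverse (b ∷ inner p)                 ∎
      where open ≡-Reasoning

    -- Reversal reverses the edge list and the inner list separately, so the new colour list is a
    -- permutation of the old one. This halves the later case analyses.
    rainbow-sym : (ce : ∀ {a b} → R a b → C) → (∀ {a b} (r : R a b) → ce (R-sym r) ≡ ce r) →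
                  (cv : V → C) → ∀ {a b} → Rainbow (colours ce cv) a b → Rainbow (colours ce cv) b a
    rainbow-sym ce ce-sym cv (l , p , short , uniq) =
      l , rev p , short ∘ rev ,
      subst Unique (sym (cong₂ _++_ (edges-rev ce ce-sym p) (cong (map cv) (inner-rev p))))
        (Unique-resp-↭ (setoid _)
          (↭⇒↭ₛ (↭-sym (↭.++⁺ (↭.↭-reverse (edges ce p)) (↭.map⁺ cv (↭.↭-reverse (inner p))))))
          uniq)

-- From a decidable relation on a finite type to a `SimpleGraph` and back.

module Encoded
  {V : Set} {N : ℕ} (code : V ↔ Fin N) (v₀ : V)
  (R : V → V → Set) (R? : ∀ a b → Dec (R a b))
  (R-sym : ∀ {a b} → R a b → R b a) (R-irr : ∀ {a} → ¬ R a a)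
  where

  open Inverse code using (to; from; strictlyInverseˡ; strictlyInverseʳ)
  open Paths R

  graph : SimpleGraph
  graph = record
    { n        = N
    ; nonempty = ≤-trans (s≤s z≤n) (toℕ<n (to v₀))
    ; adj      = λ u v → ⌊ R? (from u) (from v) ⌋
    ; adj-sym  = λ u v → trans (isYes≗does (R? (from u) (from v)))
                        (trans (does-⇔ (mk⇔ R-sym R-sym) (R? (from u) (from v)) (R? (from v) (from u)))
                               (sym (isYes≗does (R? (from v) (from u)))))
    ; adj-irr  = λ u → trans (isYes≗does (R? (from u) (from u))) (dec-false (R? (from u) (from u)) R-irr)
    }

  encodeAdj : ∀ {a b} → R a b → Adj graph (to a) (to b)
  encodeAdj {a} {b} r =
    fromWitness (subst₂ R (sym (strictlyInverseʳ a)) (sym (strictlyInverseʳ b)) r)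

  decodeAdj : ∀ {u v} → Adj graph u v → R (from u) (from v)
  decodeAdj = toWitness

  encode : ∀ {a b l} → Path R a b l → Walk graph (to a) (to b) l
  encode stop    = here
  encode (r ▹ p) = step (encodeAdj r) (encode p)

  decode : ∀ {u v l} → Walk graph u v l → Path R (from u) (from v) l
  decode here       = stop
  decode (step e P) = decodeAdj e ▹ decode P

  decodeTo : ∀ {a b l} → Walk graph (to a) (to b) l → Path R a b l
  decodeTo P = subst₂ (λ x y → Path R x y _) (strictlyInverseʳ _) (strictlyInverseʳ _) (decode P)

  internal-encode : ∀ {a b l} (p : Path R a b l) → internal (encode p) ≡ map to (inner p)
  internal-encode stop         = refl
  internal-encode (_ ▹ stop)   = refl
  internal-encode (_ ▹ q ▹ p)  = cong (_ ∷_) (internal-encode (q ▹ p))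

  inner-decode : ∀ {u v l} (P : Walk graph u v l) → map to (inner (decode P)) ≡ internal P
  inner-decode here                = refl
  inner-decode (step _ here)       = refl
  inner-decode (step _ (step q P)) = cong₂ _∷_ (strictlyInverseˡ _) (inner-decode (step q P))

  encode-shortest : ∀ {a b l} (p : Path R a b l) → Shortest p → IsGeodesic graph (encode p)
  encode-shortest p short l' Q = short (decodeTo Q)

  decode-shortest : ∀ {u v l} (P : Walk graph u v l) → IsGeodesic graph P → Shortest (decode P)
  decode-shortest P geo q =
    geo _ (subst₂ (λ x y → Walk graph x y _) (strictlyInverseˡ _) (strictlyInverseˡ _) (encode q))

  -- `F` and `F'` may read off vertex colours or total colours; `g` names the colours by numbers,
  -- and injectivity keeps them distinct.
  encode-rainbow : (F : ∀ {u v l} → Walk graph u v l → List C) (F' : ∀ {a b l} → Path R a b l → List D)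
                   (g : D → C) → (∀ {x y} → g x ≡ g y → x ≡ y) →
                   (∀ {a b l} (p : Path R a b l) → F (encode p) ≡ map g (F' p)) →
                   (∀ a b → Rainbow F' a b) →
                   ∀ u v → ∃[ l ] Σ (Walk graph u v l) λ P → IsGeodesic graph P × Unique (F P)
  encode-rainbow F F' g g-inj eq rb u v =
    subst₂ (λ x y → ∃[ l ] Σ (Walk graph x y l) λ P → IsGeodesic graph P × Unique (F P))
      (strictlyInverseˡ u) (strictlyInverseˡ v) (enc (rb (from u) (from v)))
    where
    enc : ∀ {a b} → Rainbow F' a b →
          ∃[ l ] Σ (Walk graph (to a) (to b) l) λ P → IsGeodesic graph P × Unique (F P)
    enc (l , p , short , uniq) =
      l , encode p , encode-shortest p short , subst Unique (sym (eq p)) (map⁺ g-inj uniq)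

  decode-rainbow : (F : ∀ {u v l} → Walk graph u v l → List C) (F' : ∀ {a b l} → Path R a b l → List C) →
                   (∀ {u v l} (P : Walk graph u v l) → F' (decode P) ≡ F P) →
                   (∀ u v → ∃[ l ] Σ (Walk graph u v l) λ P → IsGeodesic graph P × Unique (F P)) →
                   ∀ a b → Rainbow F' a b
  decode-rainbow F F' eq rb a b =
    subst₂ (Rainbow F') (strictlyInverseʳ a) (strictlyInverseʳ b) (dec (rb (to a) (to b)))
    where
    dec : ∀ {u v} → (∃[ l ] Σ (Walk graph u v l) λ P → IsGeodesic graph P × Unique (F P)) →
          Rainbow F' (from u) (from v)
    dec (l , P , geo , uniq) = l , decode P , decode-shortest P geo , subst Unique (sym (eq P)) uniq

  module _ {k : ℕ} (g : C → Fin k) (g-inj : ∀ {x y} → g x ≡ g y → x ≡ y) where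

    -- Edge colours are given on pairs of vertices, so they cannot depend on the proof of adjacency.
    buildSTRC : (ce : V → V → C) → (∀ {a b} → R a b → ce a b ≡ ce b a) → (cv : V → C) →
                (∀ a b → Rainbow (colours (λ {a} {b} _ → ce a b) cv) a b) → HasSTRC graph k
    buildSTRC ce ce-sym cv rb =
      g ∘ cv ∘ from , c ,
      encode-rainbow (λ P → edgeColours c P ++ vertexColours (g ∘ cv ∘ from) P)
        (colours (λ {a} {b} _ → ce a b) cv) g g-inj
        (λ p → trans (cong₂ _++_ (edges-eq p) (vertices-eq p)) (colours-map g (λ {a} {b} _ → ce a b) cv p)) rb
      where
      c : EdgeColouring graph k
      c = record { col     = λ u v _ → g (ce (from u) (from v))
                 ; col-sym = λ u v e → cong g (ce-sym (decodeAdj e)) }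

      edges-eq : ∀ {a b l} (p : Path R a b l) → edgeColours c (encode p) ≡ edges (λ {a} {b} _ → g (ce a b)) p
      edges-eq stop    = refl
      edges-eq (r ▹ p) =
        cong₂ _∷_ (cong₂ (λ x y → g (ce x y)) (strictlyInverseʳ _) (strictlyInverseʳ _)) (edges-eq p)

      vertices-eq : ∀ {a b l} (p : Path R a b l) →
                    vertexColours {graph} (g ∘ cv ∘ from) (encode p) ≡ map (g ∘ cv) (inner p)
      vertices-eq p = trans (cong (map (g ∘ cv ∘ from)) (internal-encode p))
                     (trans (sym (map-∘ (inner p)))
                            (map-cong (λ a → cong (g ∘ cv) (strictlyInverseʳ a)) (inner p)))

    buildSRVC : (cv : V → C) → (∀ a b → Rainbow (map cv ∘ inner) a b) → HasSRVC graph k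
    buildSRVC cv rb =
      g ∘ cv ∘ from ,
      encode-rainbow (vertexColours (g ∘ cv ∘ from)) (map cv ∘ inner) g g-inj
        (λ p → trans (cong (map (g ∘ cv ∘ from)) (internal-encode p))
              (trans (sym (map-∘ (inner p)))
              (trans (map-cong (λ a → cong (g ∘ cv) (strictlyInverseʳ a)) (inner p))
                     (map-∘ (inner p))))) rb

  module _ {k : ℕ} where

    pullEdge : EdgeColouring graph k → ∀ {a b} → R a b → Fin k
    pullEdge c {a} {b} r = col c (to a) (to b) (encodeAdj r)

    -- Adjacency in the graph is a truth value with at most one proof, so two opposite edges agree
    -- whichever proofs `r` and `r'` are used.
    pullEdge-sym : ∀ c {a b} (r : R a b) (r' : R b a) → pullEdge c r ≡ pullEdge c r'
    pullEdge-sym c r r' = trans (col-sym c _ _ (encodeAdj r)) (cong (col c _ _) (T-irrelevant _ _))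

    pullEdge-decode : ∀ c {u v} (e : Adj graph u v) → pullEdge c (decodeAdj e) ≡ col c u v e
    pullEdge-decode c e = col-cong (strictlyInverseˡ _) (strictlyInverseˡ _)
      where
      col-cong : ∀ {u v u' v' e e'} → u ≡ u' → v ≡ v' → col c u v e ≡ col c u' v' e'
      col-cong refl refl = cong (col c _ _) (T-irrelevant _ _)

    edges-decode : ∀ c {u v l} (P : Walk graph u v l) → edges (pullEdge c) (decode P) ≡ edgeColours c P
    edges-decode c here       = refl
    edges-decode c (step e P) = cong₂ _∷_ (pullEdge-decode c e) (edges-decode c P)

    vertices-decode : ∀ (f : Fin N → Fin k) {u v l} (P : Walk graph u v l) →
                      map (f ∘ to) (inner (decode P)) ≡ vertexColours f P
    vertices-decode f P = trans (map-∘ (inner (decode P))) (cong (map f) (inner-decode P))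

    viewSRC : ((c , _) : HasSRC graph k) → ∀ a b → Rainbow (edges (pullEdge c)) a b
    viewSRC (c , rb) = decode-rainbow (edgeColours c) (edges (pullEdge c)) (edges-decode c) rb

    viewSRVC : ((f , _) : HasSRVC graph k) → ∀ a b → Rainbow (map (f ∘ to) ∘ inner) a b
    viewSRVC (f , rb) = decode-rainbow (vertexColours f) (map (f ∘ to) ∘ inner) (vertices-decode f) rb

    viewSTRC : ((f , c , _) : HasSTRC graph k) → ∀ a b → Rainbow (colours (pullEdge c) (f ∘ to)) a b
    viewSTRC (f , c , rb) =
      decode-rainbow (λ P → edgeColours c P ++ vertexColours f P) (colours (pullEdge c) (f ∘ to))
        (λ P → cong₂ _++_ (edges-decode c P) (vertices-decode f P)) rb

  ¬complete : ∀ {a b} → a ≢ b → ¬ R a b → ¬ Complete graph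
  ¬complete {a} {b} a≢b ¬r complete =
    ¬r (subst₂ R (strictlyInverseʳ a) (strictlyInverseʳ b)
         (decodeAdj (complete (to a) (to b)
           (λ eq → a≢b (trans (sym (strictlyInverseʳ a)) (trans (cong from eq) (strictlyInverseʳ b)))))))

-- Lower bounds on path lengths, and midpoints of rainbow geodesics.

module _ {R : V → V → Set} where
  open Paths R

  adjacent-shortest : (∀ {a} → ¬ R a a) → ∀ {a b} (r : R a b) → Shortest (r ▹ stop)
  adjacent-shortest irr r stop    = ⊥-elim (irr r)
  adjacent-shortest irr r (_ ▹ _) = s≤s z≤n

  2≤length : ∀ {a b} → a ≢ b → ¬ R a b → ∀ {l} → Path R a b l → 2 ≤ l
  2≤length a≢b ¬r stop           = ⊥-elim (a≢b refl)
  2≤length a≢b ¬r (r ▹ stop)     = ⊥-elim (¬r r)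
  2≤length a≢b ¬r (_ ▹ _ ▹ _)    = s≤s (s≤s z≤n)

  3≤length : ∀ {a b} → a ≢ b → ¬ R a b → (∀ {c} → R a c → ¬ R c b) → ∀ {l} → Path R a b l → 3 ≤ l
  3≤length a≢b ¬r none stop              = ⊥-elim (a≢b refl)
  3≤length a≢b ¬r none (r ▹ stop)        = ⊥-elim (¬r r)
  3≤length a≢b ¬r none (r ▹ r' ▹ stop)   = ⊥-elim (none r r')
  3≤length a≢b ¬r none (_ ▹ _ ▹ _ ▹ _)   = s≤s (s≤s (s≤s z≤n))

  -- The path of length two, together with `a ≢ b` and non-adjacency, forces the rainbow geodesic to
  -- have exactly two edges.
  rainbow-midpoint : (ce : ∀ {a b} → R a b → C) → ∀ {a b} → a ≢ b → ¬ R a b → Path R a b 2 →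
                     Rainbow (edges ce) a b →
                     ∃[ m ] Σ (R a m) λ r → Σ (R m b) λ r' → ce r ≢ ce r'
  rainbow-midpoint ce a≢b ¬r q (_ , stop , _)                                  = ⊥-elim (a≢b refl)
  rainbow-midpoint ce a≢b ¬r q (_ , r ▹ stop , _)                              = ⊥-elim (¬r r)
  rainbow-midpoint ce a≢b ¬r q (_ , r ▹ r' ▹ stop , _ , (r≢r' ∷ _) ∷ _)        = _ , r , r' , r≢r'
  rainbow-midpoint ce a≢b ¬r q (_ , _ ▹ _ ▹ _ ▹ _ , short , _) with short q
  ... | s≤s (s≤s ())

-- Among three values in at most two colours two agree, and only the outer two may. This makes
-- colours alternate.
≢-≢⇒≡ : ∀ {j} → j < 3 → {x y z : Fin j} → x ≢ y → y ≢ z → x ≡ z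
≢-≢⇒≡ j<3 {x} {y} {z} x≢y y≢z with pigeonhole j<3 (lookup (x ∷ y ∷ z ∷ []))
... | 0F , 1F , _ , eq = contradiction eq x≢y
... | 0F , 2F , _ , eq = eq
... | 1F , 2F , _ , eq = contradiction eq y≢z
... | 1F , 1F , s≤s () , _
... | 2F , 1F , s≤s () , _
... | 2F , 2F , s≤s (s≤s ()) , _

-- Part (a): the pentagon with one vertex blown up.

module BlownUpPentagon (m : ℕ) where

  next : Fin 5 → Fin 5
  next = lookup (1F ∷ 2F ∷ 3F ∷ 4F ∷ 0F ∷ [])

  C₅ : Fin 5 → Fin 5 → Set
  C₅ c d = next c ≡ d ⊎ next d ≡ c

  C₅? : ∀ c d → Dec (C₅ c d)
  C₅? c d = (next c ≟ d) ⊎-dec (next d ≟ c)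

  V₅ : Set
  V₅ = Fin (5 + m)

  -- All indices from 4 on fall into class `4F`, the clique of `1 + m` vertices; every other class
  -- is a singleton.
  class : V₅ → Fin 5
  class 0F                        = 0F
  class 1F                        = 1F
  class 2F                        = 2F
  class 3F                        = 3F
  class (suc (suc (suc (suc _)))) = 4F

  representative : Fin 5 → V₅
  representative c = inject≤ c (s≤s (s≤s (s≤s (s≤s (s≤s z≤n)))))

  class-representative : ∀ c → class (representative c) ≡ c
  class-representative 0F = refl
  class-representative 1F = refl
  class-representative 2F = refl
  class-representative 3F = refl
  class-representative 4F = refl

  R : V₅ → V₅ → Set
  R u v = u ≢ v × (class u ≡ class v ⊎ C₅ (class u) (class v))

  R? : ∀ u v → Dec (R u v)
  R? u v = ¬? (u ≟ v) ×-dec ((class u ≟ class v) ⊎-dec C₅? (class u) (class v))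

  C₅-sym : ∀ {c d} → C₅ c d → C₅ d c
  C₅-sym (inj₁ eq) = inj₂ eq
  C₅-sym (inj₂ eq) = inj₁ eq

  R-sym : ∀ {u v} → R u v → R v u
  R-sym (u≢v , inj₁ eq) = u≢v ∘ sym , inj₁ (sym eq)
  R-sym (u≢v , inj₂ e)  = u≢v ∘ sym , inj₂ (C₅-sym e)

  R-irr : ∀ {u} → ¬ R u u
  R-irr (u≢u , _) = u≢u refl

  open Encoded (↔-id V₅) 0F R R? R-sym R-irr public
  open Paths R

  C₅⇒≢ : ∀ c d → C₅ c d → c ≢ d
  C₅⇒≢ = from-yes (all? λ c → all? λ d → C₅? c d →-dec ¬? (c ≟ d))

  fromC₅ : ∀ {u v} → C₅ (class u) (class v) → R u v
  fromC₅ e = C₅⇒≢ _ _ e ∘ cong class , inj₂ e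

  -- Each class gets the one colour missing on the two pentagon edges at it.
  vertexColour₅ : Fin 5 → Fin 3
  vertexColour₅ = lookup (1F ∷ 2F ∷ 2F ∷ 2F ∷ 0F ∷ [])

  -- A pentagon edge is named by its end `c` with the other end equal to `next c`; in this order the
  -- five edges have colours 0, 1, 0, 1, 2.
  edgeColour₅ : Fin 5 → Fin 5 → Fin 3
  edgeColour₅ c d = lookup (0F ∷ 1F ∷ 0F ∷ 1F ∷ 2F ∷ []) (choose (does (next c ≟ d)))
    where
    choose : Bool → Fin 5
    choose Bool.true  = c
    choose Bool.false = d

  edgeColour₅-sym : ∀ c d → c ≡ d ⊎ C₅ c d → edgeColour₅ c d ≡ edgeColour₅ d c
  edgeColour₅-sym =
    from-yes (all? λ c → all? λ d → ((c ≟ d) ⊎-dec C₅? c d) →-dec (edgeColour₅ c d ≟ edgeColour₅ d c))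

  rainbow₅ : ∀ c d → c ≢ d → ¬ C₅ c d →
             ∃[ e ] (C₅ c e × C₅ e d × Unique (edgeColour₅ c e ∷ edgeColour₅ e d ∷ vertexColour₅ e ∷ []))
  rainbow₅ = from-yes (all? λ c → all? λ d → ¬? (c ≟ d) →-dec ¬? (C₅? c d) →-dec
    any? λ e → C₅? c e ×-dec C₅? e d ×-dec
      DecUnique.unique? _≟_ (edgeColour₅ c e ∷ edgeColour₅ e d ∷ vertexColour₅ e ∷ []))

  rainbow : ∀ u v → Rainbow (colours (λ {a} {b} _ → edgeColour₅ (class a) (class b)) (vertexColour₅ ∘ class)) u v
  rainbow u v with u ≟ v
  ... | yes refl = 0 , stop , (λ _ → z≤n) , []
  ... | no u≢v with R? u v
  ... | yes r = 1 , r ▹ stop , adjacent-shortest R-irr r , [] ∷ []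
  ... | no ¬r with rainbow₅ (class u) (class v) (λ eq → ¬r (u≢v , inj₁ eq)) (λ e → ¬r (u≢v , inj₂ e))
  -- Writing `e` as the class of its representative turns the two pentagon edges into edges at an
  -- actual vertex.
  ... | e , ce , ed , uniq rewrite sym (class-representative e) =
    2 , fromC₅ ce ▹ fromC₅ ed ▹ stop , 2≤length u≢v ¬r , uniq

  hasSTRC : HasSTRC graph 3
  hasSTRC = buildSTRC id id (λ u v → edgeColour₅ (class u) (class v))
    (λ { (_ , e) → edgeColour₅-sym _ _ e }) (vertexColour₅ ∘ class) rainbow

  AtMost1 : Fin 5 → Fin 5 → Set
  AtMost1 c d = c ≡ d ⊎ C₅ c d

  AtMost1? : ∀ c d → Dec (AtMost1 c d)
  AtMost1? c d = (c ≟ d) ⊎-dec C₅? c d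

  next² : ∀ c → ¬ AtMost1 c (next (next c))
  next² = from-yes (all? λ c → ¬? (AtMost1? c (next (next c))))

  -- Two vertices at distance two on a pentagon have a single common neighbour; checked over all
  -- pairs.
  between : ∀ c e → AtMost1 c e → AtMost1 e (next (next c)) → e ≡ next c
  between = from-yes (all? λ c → all? λ e →
    AtMost1? c e →-dec AtMost1? e (next (next c)) →-dec (e ≟ next c))

  class-singleton : ∀ u → class u ≢ 4F → u ≡ representative (class u)
  class-singleton 0F                        _   = refl
  class-singleton 1F                        _   = refl
  class-singleton 2F                        _   = refl
  class-singleton 3F                        _   = refl
  class-singleton (suc (suc (suc (suc _)))) ≢4F = contradiction refl ≢4F

  ¬hasSRC : ∀ j → j < 3 → ¬ HasSRC graph j
  ¬hasSRC j j<3 src@(c , _) =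
    -- The colouring itself chooses the clique vertex `a`. Consecutive edges of the closed walk 3,
    -- a, 0, 1, 2, 3 differ in colour, so the colour of a-0 equals that of 1-2, which equals that of
    -- 3-a, although 3-a and a-0 differ.
    let (a , ra , ra' , a≢a' , ca) = detour 3F 0F (fromC₅ {v = 4F} (inj₁ refl)) (fromC₅ (inj₁ refl)) refl refl
        r₀ = fromC₅ {0F} {1F} (inj₁ refl) ; r₁ = fromC₅ {1F} {2F} (inj₁ refl) ; r₂ = fromC₅ {2F} {3F} (inj₁ refl)
        e₁ = ≢-≢⇒≡ j<3 (consecutive (λ ()) ra' r₀ (cong next (sym ca)) refl) (consecutive (λ ()) r₀ r₁ refl refl)
        e₂ = ≢-≢⇒≡ j<3 (consecutive (λ ()) r₁ r₂ refl refl) (consecutive (λ ()) r₂ ra refl ca)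
    in a≢a' (sym (trans e₁ e₂))
    where
    ce : ∀ {u v} → R u v → Fin j
    ce = pullEdge c

    ce-irrelevant : ∀ {u v} (r r' : R u v) → ce r ≡ ce r'
    ce-irrelevant r r' = trans (pullEdge-sym c r (R-sym r)) (pullEdge-sym c (R-sym r) r')

    -- The given path only shows that the distance is two; the rainbow geodesic may pass through
    -- another vertex `w'`, but one of the same class as `w`.
    detour : ∀ u v {w} → R u w → R w v → class w ≡ next (class u) → class v ≡ next (class w) →
             ∃[ w' ] Σ (R u w') λ r → Σ (R w' v) λ r' → ce r ≢ ce r' × class w' ≡ next (class u)
    detour u v r r' eq eq' =
      let v≡ = trans eq' (cong next eq)
          far = λ near → next² (class u) (subst (AtMost1 (class u)) v≡ near)
          (w' , s , s' , s≢s') = rainbow-midpoint ce (far ∘ inj₁ ∘ cong class) (far ∘ proj₂)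
                                    (r ▹ r' ▹ stop) (viewSRC src u v)
      in w' , s , s' , s≢s' , between (class u) (class w') (proj₂ s) (subst (AtMost1 (class w')) v≡ (proj₂ s'))

    -- Outside the clique the class of `w` is a singleton, so the detour has to run through `w`
    -- itself.
    consecutive : ∀ {u w v} → class w ≢ 4F → (r : R u w) (r' : R w v) →
                  class w ≡ next (class u) → class v ≡ next (class w) → ce r ≢ ce r'
    consecutive {u} {w} {v} w≢4 r r' eq eq' with detour u v r r' eq eq'
    ... | w' , s , s' , s≢s' , eq'' with trans (class-singleton w' (λ w'≡4 → w≢4 (trans eq (trans (sym eq'') w'≡4))))
                                         (trans (cong representative (trans eq'' (sym eq))) (sym (class-singleton w w≢4)))
    ... | refl = λ r≡r' → s≢s' (trans (ce-irrelevant s r) (trans r≡r' (ce-irrelevant r' s')))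

-- Infinitude is expressed by graphs of unbounded order.
arbitrarily-large-strc≡src≡3 : ∀ m → ∃[ G ] (Connected G × m ≤ n G × Strc G 3 × Src G 3)
arbitrarily-large-strc≡src≡3 m = graph , strc⇒connected hasSTRC , m≤n+m m 5 ,
  (hasSTRC , λ j j<3 → ¬hasSRC j j<3 ∘ strc⇒src) , (strc⇒src hasSTRC , ¬hasSRC)
  where open BlownUpPentagon m

-- Part (b): the thirteen colours shared by edges and non-core vertices.

∀Bool? : {P : Bool → Set} → (∀ b → Dec (P b)) → Dec (∀ b → P b)
∀Bool? P? = map′ (λ { (t , f) true → t ; (t , f) false → f }) (λ h → h true , h false) (P? true ×-dec P? false)

-- Colours beyond the first 13 occur on core vertices only.
module Palette where

  open DecUnique (_≟_ {13}) using (unique?)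

  -- For rim-apex edges. The flag tells whether the two indices agree, so the apex of index p meets
  -- rim p in one tint and every other rim of its side in the other.
  tint : Fin 2 → Bool → Fin 13
  tint 0F true  = # 0
  tint 0F false = # 1
  tint 1F true  = # 8
  tint 1F false = # 9

  -- For link-rim edges. A link has only one neighbour on side 0, so one colour serves there; on
  -- side 1 the flag marks one distinguished rim vertex of each link.
  stem : Fin 2 → Bool → Fin 13
  stem 0F _     = # 3
  stem 1F true  = # 5
  stem 1F false = # 6

  rimColour : Fin 2 → Fin 13
  rimColour 0F = # 2
  rimColour 1F = # 7

  hubColour : Fin 13
  hubColour = # 4

  -- Families 0 and 1 are for core-rim edges of the two sides, family 2 for edges inside the core.
  -- Families 0 and 1 reuse colours of the opposite side, which the chosen geodesics through those
  -- edges avoid.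
  shade : Fin 3 → Fin 3 → Fin 13
  shade 0F = lookup (# 5 ∷ # 6 ∷ # 7 ∷ [])
  shade 1F = lookup (# 0 ∷ # 1 ∷ # 2 ∷ [])
  shade 2F = lookup (# 10 ∷ # 11 ∷ # 12 ∷ [])

  spokeShade : Fin 2 → Fin 3 → Fin 13
  spokeShade b = shade (b ↑ˡ 1)

  shade-injective : ∀ κ k k' → shade κ k ≡ shade κ k' → k ≡ k'
  shade-injective = from-yes (all? λ κ → all? λ k → all? λ k' → (shade κ k ≟ shade κ k') →-dec (k ≟ k'))

  shade-disjoint : ∀ κ κ' k k' → shade κ k ≡ shade κ' k' → κ ≡ κ'
  shade-disjoint = from-yes (all? λ κ → all? λ κ' → all? λ k → all? λ k' → (shade κ k ≟ shade κ' k') →-dec (κ ≟ κ'))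

  -- This and the following checks are named after the vertices of a geodesic; the list holds its
  -- edge colours and then its inner vertex colours, for all flags and shades that the geodesic may
  -- show.
  rim-apex-rim : ∀ b → Unique (tint b true ∷ tint b false ∷ hubColour ∷ [])
  rim-apex-rim = from-yes (all? λ b → unique? (tint b true ∷ tint b false ∷ hubColour ∷ []))

  apex-rim-apex : ∀ b → Unique (tint b true ∷ tint b false ∷ rimColour b ∷ [])
  apex-rim-apex = from-yes (all? λ b → unique? (tint b true ∷ tint b false ∷ rimColour b ∷ []))

  link-rim-link : Unique (stem 1F true ∷ stem 1F false ∷ rimColour 1F ∷ [])
  link-rim-link = from-yes (unique? (stem 1F true ∷ stem 1F false ∷ rimColour 1F ∷ []))

  rim-link-rim : ∀ e e' → Unique (stem 0F e ∷ stem 1F e' ∷ hubColour ∷ [])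
  rim-link-rim = from-yes (∀Bool? λ e → ∀Bool? λ e' → unique? (stem 0F e ∷ stem 1F e' ∷ hubColour ∷ []))

  apex-rim-core : ∀ b e k → Unique (tint b e ∷ spokeShade b k ∷ rimColour b ∷ [])
  apex-rim-core = from-yes (all? λ b → ∀Bool? λ e → all? λ k → unique? (tint b e ∷ spokeShade b k ∷ rimColour b ∷ []))

  apex-rim-link : ∀ b e e' → Unique (tint b e ∷ stem b e' ∷ rimColour b ∷ [])
  apex-rim-link = from-yes (all? λ b → ∀Bool? λ e → ∀Bool? λ e' → unique? (tint b e ∷ stem b e' ∷ rimColour b ∷ []))

  link-rim-core : ∀ e k → Unique (stem 1F e ∷ spokeShade 1F k ∷ rimColour 1F ∷ [])
  link-rim-core = from-yes (∀Bool? λ e → all? λ k → unique? (stem 1F e ∷ spokeShade 1F k ∷ rimColour 1F ∷ []))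

  rim-apex-rim-link : ∀ b e → Unique (tint b true ∷ tint b false ∷ stem b e ∷ hubColour ∷ rimColour b ∷ [])
  rim-apex-rim-link = from-yes (all? λ b → ∀Bool? λ e →
    unique? (tint b true ∷ tint b false ∷ stem b e ∷ hubColour ∷ rimColour b ∷ []))

  apex-rim-link-rim : ∀ b b' e e' e'' → b ≢ b' →
                      Unique (tint b e ∷ stem b e' ∷ stem b' e'' ∷ rimColour b ∷ hubColour ∷ [])
  apex-rim-link-rim = from-yes (all? λ b → all? λ b' → ∀Bool? λ e → ∀Bool? λ e' → ∀Bool? λ e'' → ¬? (b ≟ b') →-dec
    unique? (tint b e ∷ stem b e' ∷ stem b' e'' ∷ rimColour b ∷ hubColour ∷ []))

  apex-rim-link-rim-apex : ∀ e₁ e₂ e₃ e₄ →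
    Unique (tint 0F e₁ ∷ stem 0F e₂ ∷ stem 1F e₃ ∷ tint 1F e₄ ∷ rimColour 0F ∷ hubColour ∷ rimColour 1F ∷ [])
  apex-rim-link-rim-apex = from-yes (∀Bool? λ e₁ → ∀Bool? λ e₂ → ∀Bool? λ e₃ → ∀Bool? λ e₄ →
    unique? (tint 0F e₁ ∷ stem 0F e₂ ∷ stem 1F e₃ ∷ tint 1F e₄ ∷ rimColour 0F ∷ hubColour ∷ rimColour 1F ∷ []))

-- Part (b): the graph of core, rims, apices and links.

module CoreAndRims (m : ℕ) where

  open Palette

  Colour Side Index : Set
  Colour = Fin (13 + m)
  Side   = Fin 2
  -- The third coordinate only makes room for σ.
  Index  = Colour × Colour × Fin 3

  _≟ᴵ_ : DecidableEquality Index
  _≟ᴵ_ = ×.≡-dec _≟_ (×.≡-dec _≟_ _≟_)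

  end : Side → Index → Colour
  end 0F (i , _ , _) = i
  end 1F (_ , j , _) = j

  cycle : Fin 3 → Fin 3
  cycle = lookup (1F ∷ 2F ∷ 0F ∷ [])

  -- Rim `σ p` of side 1 is the one marked by the stems of link `p`. As `σ` keeps both ends, it also
  -- supplies a second index hanging on the same core vertices.
  σ : Index → Index
  σ (i , j , k) = i , j , cycle k

  σ≢ : ∀ p → σ p ≢ p
  σ≢ (_ , _ , k) eq = from-yes (all? λ k → ¬? (cycle k ≟ k)) k (cong (proj₂ ∘ proj₂) eq)

  -- If `q` is `σ p`, then `σ q` still differs from `p`; this is why the third coordinate has three
  -- values rather than two.
  σσ≢ : ∀ p → σ (σ p) ≢ p
  σσ≢ (_ , _ , k) eq = from-yes (all? λ k → ¬? (cycle (cycle k) ≟ k)) k (cong (proj₂ ∘ proj₂) eq)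

  σ-injective : ∀ {p q} → σ p ≡ σ q → p ≡ q
  σ-injective {_ , _ , k} {_ , _ , k'} eq =
    cong₂ _,_ (cong proj₁ eq) (cong₂ _,_ (cong (proj₁ ∘ proj₂) eq)
      (from-yes (all? λ k → all? λ k' → (cycle k ≟ cycle k') →-dec (k ≟ k')) k k' (cong (proj₂ ∘ proj₂) eq)))

  -- Link `p` joins rim `p` of side 0 to all rims of side 1 but `p`. Only opposite rims of equal
  -- index are left to the core.
  Touch : Side → Index → Index → Set
  Touch 0F p q = p ≡ q
  Touch 1F p q = p ≢ q

  Touch? : ∀ b p q → Dec (Touch b p q)
  Touch? 0F p q = p ≟ᴵ q
  Touch? 1F p q = ¬? (p ≟ᴵ q)

  Vertex : Set
  Vertex = Colour ⊎ (Side × Index) ⊎ (Side × Index) ⊎ Index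

  pattern core i   = inj₁ i
  pattern rim b p  = inj₂ (inj₁ (b , p))
  pattern apex b p = inj₂ (inj₂ (inj₁ (b , p)))
  pattern link p   = inj₂ (inj₂ (inj₂ p))

  data R : Vertex → Vertex → Set where
    cc : ∀ {i j} → i ≢ j → R (core i) (core j)
    cr : ∀ {i b p} → end b p ≡ i → R (core i) (rim b p)
    rc : ∀ {i b p} → end b p ≡ i → R (rim b p) (core i)
    ra : ∀ {b p q} → R (rim b p) (apex b q)
    ar : ∀ {b p q} → R (apex b q) (rim b p)
    lr : ∀ {b p q} → Touch b p q → R (link p) (rim b q)
    rl : ∀ {b p q} → Touch b p q → R (rim b q) (link p)

  R? : ∀ a b → Dec (R a b)
  R? (core i)   (core j)    = map′ cc (λ { (cc i≢j) → i≢j }) (¬? (i ≟ j))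
  R? (core i)   (rim b p)   = map′ cr (λ { (cr eq) → eq }) (end b p ≟ i)
  R? (core _)   (apex _ _)  = no λ ()
  R? (core _)   (link _)    = no λ ()
  R? (rim b p)  (core i)    = map′ rc (λ { (rc eq) → eq }) (end b p ≟ i)
  R? (rim _ _)  (rim _ _)   = no λ ()
  R? (rim b _)  (apex b' _) = map′ (λ { refl → ra }) (λ { ra → refl }) (b ≟ b')
  R? (rim b q)  (link p)    = map′ rl (λ { (rl t) → t }) (Touch? b p q)
  R? (apex _ _) (core _)    = no λ ()
  R? (apex b _) (rim b' _)  = map′ (λ { refl → ar }) (λ { ar → refl }) (b ≟ b')
  R? (apex _ _) (apex _ _)  = no λ ()
  R? (apex _ _) (link _)    = no λ ()
  R? (link _)   (core _)    = no λ ()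
  R? (link p)   (rim b q)   = map′ lr (λ { (lr t) → t }) (Touch? b p q)
  R? (link _)   (apex _ _)  = no λ ()
  R? (link _)   (link _)    = no λ ()

  R-sym : ∀ {a b} → R a b → R b a
  R-sym (cc i≢j) = cc (i≢j ∘ sym)
  R-sym (cr eq)  = rc eq
  R-sym (rc eq)  = cr eq
  R-sym ra       = ar
  R-sym ar       = ra
  R-sym (lr t)   = rl t
  R-sym (rl t)   = lr t

  R-irr : ∀ {a} → ¬ R a a
  R-irr (cc i≢i) = i≢i refl

  -- Abstract because the order of the graph unfolds to a huge unary term.
  abstract
    Vertex-finite : ∃[ N ] (Vertex ↔ Fin N)
    Vertex-finite =
      let index = ×-code (↔-id Colour) (×-code (↔-id Colour) (↔-id (Fin 3)))
          sided = ×-code (↔-id Side) index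
      in _ , ⊎-code (↔-id Colour) (⊎-code sided (⊎-code sided index))

  open Encoded (proj₂ Vertex-finite) (core 0F) R R? R-sym R-irr public
  open Paths R
  open Reversal R-sym

  -- Part (b): the total colouring.

  constant : Fin 13 → Colour
  constant c = c ↑ˡ m

  constants-unique : ∀ {cs} → Unique cs → Unique (map constant cs)
  constants-unique = map⁺ (↑ˡ-injective m _ _)

  Free : Fin 3 → Colour → Colour → Fin 3 → Set
  Free κ i j k = constant (shade κ k) ≢ i × constant (shade κ k) ≢ j

  Free? : ∀ κ i j k → Dec (Free κ i j k)
  Free? κ i j k = ¬? (constant (shade κ k) ≟ i) ×-dec ¬? (constant (shade κ k) ≟ j)

  firstTrue : Bool → Bool → Fin 3
  firstTrue true  _     = 0F
  firstTrue false true  = 1F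
  firstTrue false false = 2F

  abstract
    -- A core vertex may carry one of the first thirteen colours. Three shades are on offer, and the
    -- colours `i` and `j` block at most two of them.
    avoid : Fin 3 → Colour → Colour → Fin 3
    avoid κ i j = firstTrue (does (Free? κ i j 0F)) (does (Free? κ i j 1F))

    avoid-free : ∀ κ i j → Free κ i j (avoid κ i j)
    avoid-free κ i j = first (Free? κ i j 0F) (Free? κ i j 1F)
      where
      c : Fin 3 → Colour
      c k = constant (shade κ k)

      c-injective : ∀ {k k'} → c k ≡ c k' → k ≡ k'
      c-injective {k} {k'} eq = shade-injective κ k k' (↑ˡ-injective m _ _ eq)

      taken : ∀ k → ¬ Free κ i j k → c k ≡ i ⊎ c k ≡ j
      taken k ¬free with c k ≟ i | c k ≟ j
      ... | yes eq | _      = inj₁ eq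
      ... | no _   | yes eq = inj₂ eq
      ... | no ≢i  | no ≢j  = contradiction (≢i , ≢j) ¬free

      last : c 0F ≡ i ⊎ c 0F ≡ j → c 1F ≡ i ⊎ c 1F ≡ j → c 2F ≢ i × c 2F ≢ j
      last (inj₁ refl) (inj₂ refl) = (λ ()) ∘ c-injective , (λ ()) ∘ c-injective
      last (inj₂ refl) (inj₁ refl) = (λ ()) ∘ c-injective , (λ ()) ∘ c-injective
      last (inj₁ e)    (inj₁ e')   = contradiction (c-injective (trans e (sym e'))) λ ()
      last (inj₂ e)    (inj₂ e')   = contradiction (c-injective (trans e (sym e'))) λ ()

      first : (d₀ : Dec (Free κ i j 0F)) (d₁ : Dec (Free κ i j 1F)) → Free κ i j (firstTrue (does d₀) (does d₁))
      first (yes free) _          = free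
      first (no _)     (yes free) = free
      first (no ¬free) (no ¬free') = last (taken 0F ¬free) (taken 1F ¬free')

    -- Makes the colour of a core edge independent of its direction.
    avoid-sym : ∀ κ i j → avoid κ i j ≡ avoid κ j i
    avoid-sym κ i j = cong₂ firstTrue (swapped 0F) (swapped 1F)
      where
      swapped : ∀ k → does (Free? κ i j k) ≡ does (Free? κ j i k)
      swapped k = does-⇔ (mk⇔ swap swap) (Free? κ i j k) (Free? κ j i k)

  -- Both ends of `p` are avoided, not only the one the rim vertex hangs on, because the geodesic
  -- between the two rims of index `p` passes through both.
  spoke : Side → Index → Colour
  spoke b p = constant (spokeShade b (avoid (b ↑ˡ 1) (end 0F p) (end 1F p)))

  chord : Colour → Colour → Colour
  chord i j = constant (shade 2F (avoid 2F i j))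

  shades-differ : ∀ κ κ' k k' → κ ≢ κ' → constant (shade κ k) ≢ constant (shade κ' k')
  shades-differ κ κ' k k' κ≢κ' eq = κ≢κ' (shade-disjoint κ κ' k k' (↑ˡ-injective m _ _ eq))

  spoke≢end : ∀ b b' p → spoke b p ≢ end b' p
  spoke≢end b 0F p = proj₁ (avoid-free (b ↑ˡ 1) _ _)
  spoke≢end b 1F p = proj₂ (avoid-free (b ↑ˡ 1) _ _)

  chord≢spoke : ∀ i j b p → chord i j ≢ spoke b p
  chord≢spoke i j 0F p = shades-differ 2F 0F (avoid 2F i j) (avoid 0F (end 0F p) (end 1F p)) λ ()
  chord≢spoke i j 1F p = shades-differ 2F 1F (avoid 2F i j) (avoid 1F (end 0F p) (end 1F p)) λ ()

  spokes-differ : ∀ p → spoke 0F p ≢ spoke 1F p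
  spokes-differ p = shades-differ 0F 1F (avoid 0F (end 0F p) (end 1F p)) (avoid 1F (end 0F p) (end 1F p)) λ ()

  abstract
    same : Index → Index → Bool
    same p q = does (p ≟ᴵ q)

    same-≡ : ∀ p → same p p ≡ true
    same-≡ p = dec-true (p ≟ᴵ p) refl

    same-≢ : ∀ {p q} → p ≢ q → same p q ≡ false
    same-≢ {p} {q} = dec-false (p ≟ᴵ q)

  vertexColour : Vertex → Colour
  vertexColour (core i)   = i
  vertexColour (rim b _)  = constant (rimColour b)
  vertexColour (apex _ _) = constant hubColour
  vertexColour (link _)   = constant hubColour

  edgeColour : Vertex → Vertex → Colour
  edgeColour (core i)   (core j)   = chord i j
  edgeColour (core _)   (rim b p)  = spoke b p
  edgeColour (rim b p)  (core _)   = spoke b p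
  edgeColour (rim b p)  (apex _ q) = constant (tint b (same p q))
  edgeColour (apex b q) (rim _ p)  = constant (tint b (same p q))
  edgeColour (link p)   (rim b q)  = constant (stem b (same (σ p) q))
  edgeColour (rim b q)  (link p)   = constant (stem b (same (σ p) q))
  edgeColour _          _          = 0F

  edgeColour-sym : ∀ {a b} → R a b → edgeColour a b ≡ edgeColour b a
  edgeColour-sym (cc {i} {j} _) = cong (constant ∘ shade 2F) (avoid-sym 2F i j)
  edgeColour-sym (cr _) = refl
  edgeColour-sym (rc _) = refl
  edgeColour-sym ra     = refl
  edgeColour-sym ar     = refl
  edgeColour-sym (lr _) = refl
  edgeColour-sym (rl _) = refl

  -- Part (b): rainbow geodesics between all pairs of vertices.

  allColours : ∀ {a b l} → Path R a b l → List Colour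
  allColours = colours (λ {a} {b} _ → edgeColour a b) vertexColour

  Joined : Vertex → Vertex → Set
  Joined = Rainbow allColours

  flip : ∀ {a b} → Joined a b → Joined b a
  flip = rainbow-sym (λ {a} {b} _ → edgeColour a b) (sym ∘ edgeColour-sym) vertexColour

  self : ∀ {a} → Joined a a
  self = 0 , stop , (λ _ → z≤n) , []

  adjacent : ∀ {a b} → R a b → Joined a b
  adjacent r = 1 , r ▹ stop , adjacent-shortest R-irr r , [] ∷ []

  core-rim : ∀ {i b p} → end b p ≢ i → Joined (core i) (rim b p)
  core-rim {i} {b} {p} ≢i = 2 , cc (≢i ∘ sym) ▹ cr refl ▹ stop , 2≤length (λ ()) (λ { (cr eq) → ≢i eq }) ,
    (chord≢spoke i _ b p ∷ proj₂ (avoid-free 2F i _) ∷ []) ∷ (spoke≢end b b p ∷ []) ∷ [] ∷ []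

  apex-core : ∀ b q i → Joined (apex b q) (core i)
  apex-core b q i = 2 , ar {p = p} ▹ rc (end-p b) ▹ stop , 2≤length (λ ()) (λ ()) ,
    constants-unique (apex-rim-core b (same p q) _)
    where
    p : Index
    p = i , i , 0F
    end-p : ∀ b → end b p ≡ i
    end-p 0F = refl
    end-p 1F = refl

  -- On side 1 link `p` misses only rim `p`. So the index (i , i , 0) serves unless it is `p`, and
  -- then `σ p` does.
  link-core : ∀ p i → Joined (link p) (core i)
  link-core p i = let (q , p≢q , eq) = away in
    2 , lr p≢q ▹ rc eq ▹ stop , 2≤length (λ ()) (λ ()) ,
    constants-unique (link-rim-core (same (σ p) q) (avoid 1F (end 0F q) (end 1F q)))
    where
    away : ∃[ q ] (p ≢ q × end 1F q ≡ i)
    away with p ≟ᴵ (i , i , 0F)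
    ... | yes refl = σ p , σ≢ p ∘ sym , refl
    ... | no p≢    = (i , i , 0F) , p≢ , refl

  -- Through the apex of index `p`: its edge to rim `p` has the tint of equal indices, its edge to
  -- rim `q` the other one.
  rim-rim : ∀ b {p q} → p ≢ q → Joined (rim b p) (rim b q)
  rim-rim b {p} {q} p≢q = 2 , ra {q = p} ▹ ar ▹ stop , 2≤length (λ { refl → p≢q refl }) (λ ()) ,
    unique (same-≡ p) (same-≢ (p≢q ∘ sym))
    where
    unique : ∀ {e e'} → e ≡ true → e' ≡ false →
             Unique (map constant (tint b e ∷ tint b e' ∷ hubColour ∷ []))
    unique refl refl = constants-unique (rim-apex-rim b)

  rims-via-link : ∀ {p q} → p ≢ q → Joined (rim 0F p) (rim 1F q)
  rims-via-link {p} {q} p≢q = 2 , rl {p = p} refl ▹ lr p≢q ▹ stop , 2≤length (λ ()) (λ ()) ,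
    constants-unique (rim-link-rim (same (σ p) p) (same (σ p) q))

  rims-via-core : ∀ p → Joined (rim 0F p) (rim 1F p)
  rims-via-core p with end 0F p ≟ end 1F p
  ... | yes eq = 2 , rc refl ▹ cr (sym eq) ▹ stop , 2≤length (λ ()) (λ ()) ,
    (spokes-differ p ∷ spoke≢end 0F 0F p ∷ []) ∷ (spoke≢end 1F 0F p ∷ []) ∷ [] ∷ []
  ... | no i≢j = 3 , rc refl ▹ cc i≢j ▹ cr refl ▹ stop ,
    -- A common neighbour would be a core vertex, forcing equal ends, or a link, which would have
    -- index `p` and also an index other than `p`.
    3≤length (λ ()) (λ ()) (λ { (rc e) (cr e') → i≢j (trans e (sym e')) ; (rl refl) (lr p≢p) → p≢p refl }) ,
    ((chord≢spoke _ _ 0F p ∘ sym) ∷ spokes-differ p ∷ spoke≢end 0F 0F p ∷ spoke≢end 0F 1F p ∷ []) ∷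
    (chord≢spoke _ _ 1F p ∷ proj₁ (avoid-free 2F _ _) ∷ proj₂ (avoid-free 2F _ _) ∷ []) ∷
    (spoke≢end 1F 0F p ∷ spoke≢end 1F 1F p ∷ []) ∷ (i≢j ∷ []) ∷ [] ∷ []

  touching : ∀ b p → ∃[ q ] Touch b p q
  touching 0F p = p , refl
  touching 1F p = σ p , σ≢ p ∘ sym

  -- On side 1, not touching means having index `p`, whereas the chosen neighbour has index `σ p`.
  touching≢ : ∀ b p {q} → ¬ Touch b p q → proj₁ (touching b p) ≢ q
  touching≢ 0F p ¬t = ¬t
  touching≢ 1F p {q} ¬t eq = σ≢ p (trans eq (sym (decidable-stable (p ≟ᴵ q) ¬t)))

  -- From the rim through the apex of its own index to a neighbour of the link; the two tints differ
  -- because that neighbour has another index.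
  rim-link : ∀ {b p q} → ¬ Touch b p q → Joined (rim b q) (link p)
  rim-link {b} {p} {q} ¬t with touching b p | touching≢ b p ¬t
  ... | r , t | r≢q = 3 , ra {q = q} ▹ ar ▹ rl t ▹ stop ,
    3≤length (λ ()) (λ { (rl t) → ¬t t }) (λ { (rc _) () ; ra () ; (rl _) () }) ,
    unique (same-≡ q) (same-≢ r≢q)
    where
    unique : ∀ {e e'} → e ≡ true → e' ≡ false →
             Unique (map constant (tint b e ∷ tint b e' ∷ stem b (same (σ p) r) ∷ hubColour ∷ rimColour b ∷ []))
    unique refl refl = constants-unique (rim-apex-rim-link b (same (σ p) r))

  apex-opposite-rim : ∀ {b b'} → b ≢ b' → ∀ {r p q q'} → Touch b p q → Touch b' p q' → Joined (apex b r) (rim b' q')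
  apex-opposite-rim {b} {b'} b≢b' {r} {p} {q} {q'} t t' = 3 , ar ▹ rl t ▹ lr t' ▹ stop ,
    3≤length (λ ()) (λ { ar → b≢b' refl }) (λ { ar () }) ,
    constants-unique (apex-rim-link-rim b b' (same q r) (same (σ p) q) (same (σ p) q') b≢b')

  apex-apex : ∀ b {p q} → p ≢ q → Joined (apex b p) (apex b q)
  apex-apex b {p} {q} p≢q = 2 , ar {p = p} ▹ ra ▹ stop , 2≤length (λ { refl → p≢q refl }) (λ ()) ,
    unique (same-≡ p) (same-≢ p≢q)
    where
    unique : ∀ {e e'} → e ≡ true → e' ≡ false →
             Unique (map constant (tint b e ∷ tint b e' ∷ rimColour b ∷ []))
    unique refl refl = constants-unique (apex-rim-apex b)

  -- An apex is adjacent only to rims of its side, and opposite rims are never adjacent, so at least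
  -- four edges are required. The path uses link `p` with rims `p` and `σ p`.
  opposite-apices : ∀ p q → Joined (apex 0F p) (apex 1F q)
  opposite-apices p q = 4 , ar ▹ rl refl ▹ lr (σ≢ p ∘ sym) ▹ ra ▹ stop , short ,
    constants-unique (apex-rim-link-rim-apex (same p p) (same (σ p) p) (same (σ p) (σ p)) (same (σ p) q))
    where
    short : ∀ {l} → Path R (apex 0F p) (apex 1F q) l → 4 ≤ l
    short (() ▹ stop)
    short (ar ▹ () ▹ stop)
    short (ar ▹ rc _ ▹ () ▹ stop)
    short (ar ▹ ra ▹ () ▹ stop)
    short (ar ▹ rl _ ▹ () ▹ stop)
    short (_ ▹ _ ▹ _ ▹ _ ▹ _) = s≤s (s≤s (s≤s (s≤s z≤n)))

  apex-link : ∀ b q p → Joined (apex b q) (link p)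
  apex-link b q p with touching b p
  ... | r , t = 2 , ar ▹ rl t ▹ stop , 2≤length (λ ()) (λ ()) ,
    constants-unique (apex-rim-link b (same r q) (same (σ p) r))

  -- Through rim 1F (σ p), which distinguishes the stems at p and q.
  link-link : ∀ {p q} → p ≢ q → σ p ≢ q → Joined (link p) (link q)
  link-link {p} {q} p≢q σp≢q = 2 , lr (σ≢ p ∘ sym) ▹ rl (σp≢q ∘ sym) ▹ stop , 2≤length (λ { refl → p≢q refl }) (λ ()) ,
    unique (same-≡ (σ p)) (same-≢ (p≢q ∘ sym ∘ σ-injective))
    where
    unique : ∀ {e e'} → e ≡ true → e' ≡ false →
             Unique (map constant (stem 1F e ∷ stem 1F e' ∷ rimColour 1F ∷ []))
    unique refl refl = constants-unique link-rim-link

  rainbow : ∀ a b → Joined a b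
  rainbow (core i) (core j) with i ≟ j
  ... | yes refl = self
  ... | no i≢j   = adjacent (cc i≢j)
  rainbow (core i) (rim b p) with end b p ≟ i
  ... | yes eq = adjacent (cr eq)
  ... | no ≢i  = core-rim ≢i
  rainbow (core i) (apex b q) = flip (apex-core b q i)
  rainbow (core i) (link p)   = flip (link-core p i)
  rainbow (rim b p) (core i) with end b p ≟ i
  ... | yes eq = adjacent (rc eq)
  ... | no ≢i  = flip (core-rim ≢i)
  rainbow (rim b p) (rim b' q) with p ≟ᴵ q
  rainbow (rim 0F p) (rim 0F q) | yes refl = self
  rainbow (rim 0F p) (rim 1F q) | yes refl = rims-via-core p
  rainbow (rim 1F p) (rim 0F q) | yes refl = flip (rims-via-core p)
  rainbow (rim 1F p) (rim 1F q) | yes refl = self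
  rainbow (rim 0F p) (rim 0F q) | no p≢q = rim-rim 0F p≢q
  rainbow (rim 0F p) (rim 1F q) | no p≢q = rims-via-link p≢q
  rainbow (rim 1F p) (rim 0F q) | no p≢q = flip (rims-via-link (p≢q ∘ sym))
  rainbow (rim 1F p) (rim 1F q) | no p≢q = rim-rim 1F p≢q
  rainbow (rim b p) (link q) with Touch? b q p
  ... | yes t = adjacent (rl t)
  ... | no ¬t = rim-link ¬t
  rainbow (rim b p) (apex b' r) = flip (rainbow' b' r b p)
    where
    rainbow' : ∀ b r b' q → Joined (apex b r) (rim b' q)
    rainbow' 0F r 0F q = adjacent ar
    -- The connecting link is `σ q` here and `q` in the next case, with rim `σ q` as the neighbour
    -- of the apex in both.
    rainbow' 0F r 1F q = apex-opposite-rim (λ ()) refl (σ≢ q)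
    rainbow' 1F r 0F q = apex-opposite-rim (λ ()) (σ≢ q ∘ sym) refl
    rainbow' 1F r 1F q = adjacent ar
  rainbow (apex b q) (core i) = apex-core b q i
  rainbow (apex b r) (rim b' p) = flip (rainbow (rim b' p) (apex b r))
  rainbow (apex 0F p) (apex 1F q) = opposite-apices p q
  rainbow (apex 1F p) (apex 0F q) = flip (opposite-apices q p)
  rainbow (apex 0F p) (apex 0F q) with p ≟ᴵ q
  ... | yes refl = self
  ... | no p≢q   = apex-apex 0F p≢q
  rainbow (apex 1F p) (apex 1F q) with p ≟ᴵ q
  ... | yes refl = self
  ... | no p≢q   = apex-apex 1F p≢q
  rainbow (apex b q) (link p) = apex-link b q p
  rainbow (link p) (core i) = link-core p i
  rainbow (link p) (rim b q) with Touch? b p q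
  ... | yes t = adjacent (lr t)
  ... | no ¬t = flip (rim-link ¬t)
  rainbow (link p) (apex b q) = flip (apex-link b q p)
  rainbow (link p) (link q) with p ≟ᴵ q | σ p ≟ᴵ q
  ... | yes refl | _        = self
  ... | no p≢q   | no σp≢q  = link-link p≢q σp≢q
  ... | no p≢q   | yes refl = flip (link-link (p≢q ∘ sym) (σσ≢ p))

  hasSTRC : HasSTRC graph (13 + m)
  hasSTRC = buildSTRC id id edgeColour edgeColour-sym vertexColour rainbow

  -- Part (b): core vertices need pairwise distinct colours.

  ¬hasSRVC : ∀ j → j < 13 + m → ¬ HasSRVC graph j
  ¬hasSRVC j j<s srvc@(f , _) = <⇒≱ j<s (injective⇒≤ h-injective)
    where
    h : Vertex → Fin j
    h = f ∘ Inverse.to (proj₂ Vertex-finite)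

    -- Paths of length two would need `i ≡ k` or a link touching both rims of one index, and the
    -- only path of length three runs through cores `i` and `k`. Anything longer loses to that path.
    conflict : ∀ {i k} → i ≢ k → Rainbow (map h ∘ inner) (rim 0F (i , k , 0F)) (rim 1F (i , k , 0F)) →
               h (core i) ≢ h (core k)
    conflict i≢k (_ , rc e ▹ cr e' ▹ stop , _) = contradiction (trans e (sym e')) i≢k
    conflict i≢k (_ , rl refl ▹ lr p≢p ▹ stop , _) = contradiction refl p≢p
    conflict i≢k (_ , rc refl ▹ cc _ ▹ cr refl ▹ stop , _ , (hi≢hk ∷ _) ∷ _) = hi≢hk
    conflict i≢k (_ , ra ▹ ar ▹ () ▹ stop , _)
    conflict i≢k (_ , _ ▹ _ ▹ _ ▹ _ ▹ _ , short , _) with short (rc refl ▹ cc i≢k ▹ cr refl ▹ stop)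
    ... | s≤s (s≤s (s≤s ()))

    h-injective : ∀ {i k} → h (core i) ≡ h (core k) → i ≡ k
    h-injective {i} {k} = decidable-stable (i ≟ k) ∘ λ eq i≢k →
      conflict i≢k (viewSRVC srvc (rim 0F (i , k , 0F)) (rim 1F (i , k , 0F))) eq

  notComplete : ¬ Complete graph
  notComplete = ¬complete {apex 0F (0F , 0F , 0F)} {core 0F} (λ ()) (λ ())

strc≡srvc≡s : ∀ s → 13 ≤ s → ∃[ G ] (Connected G × Strc G s × Srvc G s)
-- The one colouring with `s` colours bounds strc and srvc from above, and the core bounds both from
-- below.
strc≡srvc≡s s 13≤s = subst (λ s → ∃[ G ] (Connected G × Strc G s × Srvc G s)) (m+[n∸m]≡n 13≤s)
  (graph , strc⇒connected hasSTRC , (hasSTRC , λ j j<s → ¬hasSRVC j j<s ∘ strc⇒srvc) ,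
   inj₂ (notComplete , strc⇒srvc hasSTRC , ¬hasSRVC))
  where open CoreAndRims (s ∸ 13)

-- Part (c): spiders and their colouring.

module Spider (T L : ℕ) where

  -- `inj₁` legs have a knee and a foot, `inj₂` legs end at the knee. At least two short legs exist,
  -- so every leg has another one beside it even for `T` zero.
  Leg : Set
  Leg = Fin T ⊎ Fin (2 + L)

  _≟ᴸ_ : DecidableEquality Leg
  _≟ᴸ_ = ≡-dec _≟_ _≟_

  Vertex : Set
  Vertex = Fin 1 ⊎ (Leg ⊎ Fin T)

  pattern hub    = inj₁ zero
  pattern knee b = inj₂ (inj₁ b)
  pattern foot i = inj₂ (inj₂ i)

  data R : Vertex → Vertex → Set where
    out  : ∀ b → R hub (knee b)
    back : ∀ b → R (knee b) hub
    down : ∀ i → R (knee (inj₁ i)) (foot i)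
    up   : ∀ i → R (foot i) (knee (inj₁ i))

  R? : ∀ a b → Dec (R a b)
  R? hub             hub             = no λ ()
  R? hub             (knee b)        = yes (out b)
  R? hub             (foot i)        = no λ ()
  R? (knee b)        hub             = yes (back b)
  R? (knee b)        (knee b')       = no λ ()
  R? (knee (inj₁ i)) (foot j) with i ≟ j
  ... | yes refl                     = yes (down i)
  ... | no i≢j                       = no λ { (down _) → i≢j refl }
  R? (knee (inj₂ l)) (foot j)        = no λ ()
  R? (foot i)        hub             = no λ ()
  R? (foot i)        (knee (inj₁ j)) with i ≟ j
  ... | yes refl                     = yes (up i)
  ... | no i≢j                       = no λ { (up _) → i≢j refl }
  R? (foot i)        (knee (inj₂ l)) = no λ ()
  R? (foot i)        (foot j)        = no λ ()

  R-sym : ∀ {a b} → R a b → R b a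
  R-sym (out b)  = back b
  R-sym (back b) = out b
  R-sym (down i) = up i
  R-sym (up i)   = down i

  R-irr : ∀ {a} → ¬ R a a
  R-irr ()

  Vertex-code : Vertex ↔ Fin _
  Vertex-code = ⊎-code (↔-id (Fin 1)) (⊎-code (⊎-code (↔-id (Fin T)) (↔-id (Fin (2 + L)))) (↔-id (Fin T)))

  open Encoded Vertex-code hub R R? R-sym R-irr public
  open Paths R
  open Reversal R-sym

  Cut Edge Item : Set
  Cut  = Fin (suc T)
  Edge = Leg ⊎ Fin T
  Item = Cut ⊎ Edge

  cutVertex : Cut → Vertex
  cutVertex zero    = hub
  cutVertex (suc i) = knee (inj₁ i)

  -- Leaves are never internal, so their value is immaterial.
  cut : Vertex → Cut
  cut (knee (inj₁ i)) = suc i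
  cut _               = zero

  vertexItem : Vertex → Item
  vertexItem = inj₁ ∘ cut

  -- Every edge and every cut vertex is its own colour, so a geodesic of the tree, which repeats
  -- nothing, is rainbow.
  edgeItem : Vertex → Vertex → Item
  edgeItem hub      (knee b) = inj₂ (inj₁ b)
  edgeItem (knee b) hub      = inj₂ (inj₁ b)
  edgeItem (knee _) (foot i) = inj₂ (inj₂ i)
  edgeItem (foot i) (knee _) = inj₂ (inj₂ i)
  edgeItem _        _        = inj₁ zero

  edgeItem-sym : ∀ {a b} → R a b → edgeItem a b ≡ edgeItem b a
  edgeItem-sym (out b)  = refl
  edgeItem-sym (back b) = refl
  edgeItem-sym (down i) = refl
  edgeItem-sym (up i)   = refl

  items : ∀ {a b l} → Path R a b l → List Item
  items = colours (λ {a} {b} _ → edgeItem a b) vertexItem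

  rainbow-flip : ∀ {a b} → Rainbow items a b → Rainbow items b a
  rainbow-flip = rainbow-sym (λ {a} {b} _ → edgeItem a b) (sym ∘ edgeItem-sym) vertexItem

  adjacent : ∀ {a b} → R a b → Rainbow items a b
  adjacent r = 1 , r ▹ stop , adjacent-shortest R-irr r , [] ∷ []

  hub-foot : ∀ i → Rainbow items hub (foot i)
  hub-foot i = 2 , out (inj₁ i) ▹ down i ▹ stop , 2≤length (λ ()) (λ ()) ,
    ((λ ()) ∷ (λ ()) ∷ []) ∷ ((λ ()) ∷ []) ∷ [] ∷ []

  knee-knee : ∀ {b b'} → b ≢ b' → Rainbow items (knee b) (knee b')
  knee-knee {b} {b'} b≢b' = 2 , back b ▹ out b' ▹ stop , 2≤length (λ { refl → b≢b' refl }) (λ ()) ,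
    ((λ { refl → b≢b' refl }) ∷ (λ ()) ∷ []) ∷ ((λ ()) ∷ []) ∷ [] ∷ []

  knee-foot : ∀ {b j} → b ≢ inj₁ j → Rainbow items (knee b) (foot j)
  knee-foot {b} {j} b≢j = 3 , back b ▹ out (inj₁ j) ▹ down j ▹ stop , short ,
    ((λ { refl → b≢j refl }) ∷ (λ ()) ∷ (λ ()) ∷ (λ ()) ∷ []) ∷ ((λ ()) ∷ (λ ()) ∷ (λ ()) ∷ []) ∷
    ((λ ()) ∷ (λ ()) ∷ []) ∷ ((λ ()) ∷ []) ∷ [] ∷ []
    where
    short : ∀ {l} → Path R (knee b) (foot j) l → 3 ≤ l
    short (down _ ▹ stop)     = contradiction refl b≢j
    short (_ ▹ _ ▹ _ ▹ _)     = s≤s (s≤s (s≤s z≤n))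

  foot-foot : ∀ {i j} → i ≢ j → Rainbow items (foot i) (foot j)
  foot-foot {i} {j} i≢j = 4 , up i ▹ back _ ▹ out _ ▹ down j ▹ stop , short ,
    ((λ ()) ∷ (λ ()) ∷ (λ { refl → i≢j refl }) ∷ (λ ()) ∷ (λ ()) ∷ (λ ()) ∷ []) ∷
    ((λ { refl → i≢j refl }) ∷ (λ ()) ∷ (λ ()) ∷ (λ ()) ∷ (λ ()) ∷ []) ∷
    ((λ ()) ∷ (λ ()) ∷ (λ ()) ∷ (λ ()) ∷ []) ∷
    ((λ ()) ∷ (λ ()) ∷ (λ ()) ∷ []) ∷
    ((λ ()) ∷ (λ { refl → i≢j refl }) ∷ []) ∷ ((λ ()) ∷ []) ∷ [] ∷ []
    where
    short : ∀ {l} → Path R (foot i) (foot j) l → 4 ≤ l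
    short stop                  = contradiction refl i≢j
    short (up _ ▹ down _ ▹ stop) = contradiction refl i≢j
    short (_ ▹ _ ▹ _ ▹ _ ▹ _)   = s≤s (s≤s (s≤s (s≤s z≤n)))

  self : ∀ {a} → Rainbow items a a
  self = 0 , stop , (λ _ → z≤n) , []

  rainbow : ∀ a b → Rainbow items a b
  rainbow hub hub = self
  rainbow hub (knee b) = adjacent (out b)
  rainbow hub (foot i) = hub-foot i
  rainbow (knee b) hub = adjacent (back b)
  rainbow (knee b) (knee b') with b ≟ᴸ b'
  ... | yes refl = self
  ... | no b≢b'  = knee-knee b≢b'
  rainbow (knee b) (foot i) with b ≟ᴸ inj₁ i
  ... | yes refl = adjacent (down i)
  ... | no b≢i   = knee-foot b≢i
  rainbow (foot i) hub = rainbow-flip (hub-foot i)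
  rainbow (foot i) (knee b) with b ≟ᴸ inj₁ i
  ... | yes refl = adjacent (up i)
  ... | no b≢i   = rainbow-flip (knee-foot b≢i)
  rainbow (foot i) (foot j) with i ≟ j
  ... | yes refl = self
  ... | no i≢j   = foot-foot i≢j

  Item-code : Item ↔ Fin _
  Item-code = ⊎-code (↔-id Cut) (⊎-code (⊎-code (↔-id (Fin T)) (↔-id (Fin (2 + L)))) (↔-id (Fin T)))

  -- The cut vertices, then the edges at the hub (long and short legs), then the edges to the feet.
  strc : ℕ
  strc = suc T + ((T + (2 + L)) + T)

  hasSTRC : HasSTRC graph strc
  hasSTRC = buildSTRC (Inverse.to Item-code) (Injection.injective (↔⇒↣ Item-code))
    edgeItem edgeItem-sym vertexItem rainbow

  hasSRVC : HasSRVC graph (suc T)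
  hasSRVC = buildSRVC id id cut λ a b →
    let (l , p , short , uniq) = rainbow a b in
    -- The vertex part of the item list is the list of cuts under `inj₁`, which is stripped off.
    l , p , short , map⁻ {f = inj₁} (subst Unique (map-∘ (inner p)) (Unique-++⁻ʳ (edges _ p) uniq))

  -- Part (c): lower bounds from geodesics between tips.

  tip : Leg → Vertex
  tip (inj₁ i) = foot i
  tip (inj₂ l) = knee (inj₂ l)

  legLength : Leg → ℕ
  legLength (inj₁ _) = 2
  legLength (inj₂ _) = 1

  descend : ∀ b → Path R hub (tip b) (legLength b)
  descend (inj₁ i) = out _ ▹ down i ▹ stop
  descend (inj₂ l) = out _ ▹ stop

  track : ∀ b b' → Path R (tip b) (tip b') (legLength b + legLength b')
  track (inj₁ i) b' = up i ▹ back _ ▹ descend b'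
  track (inj₂ l) b' = back _ ▹ descend b'

  -- Up to the length of `track`, every path between two distinct tips is the track itself; longer
  -- ones are not shortest. A general `F` covers vertex and total colourings alike.
  tips-geodesic : (F : ∀ {a b l} → Path R a b l → List C) → ∀ {b b'} → b ≢ b' →
                  Rainbow F (tip b) (tip b') → Unique (F (track b b'))
  tips-geodesic F {inj₁ i} {inj₁ j} b≢b' (_ , stop , _) = contradiction refl b≢b'
  tips-geodesic F {inj₁ i} {inj₁ j} b≢b' (_ , up _ ▹ down _ ▹ stop , _) = contradiction refl b≢b'
  tips-geodesic F {inj₁ i} {inj₁ j} b≢b' (_ , up _ ▹ down _ ▹ up _ ▹ down _ ▹ stop , _) = contradiction refl b≢b'
  tips-geodesic F {inj₁ i} {inj₁ j} b≢b' (_ , up _ ▹ back _ ▹ out _ ▹ down _ ▹ stop , _ , uniq) = uniq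
  tips-geodesic F {inj₁ i} {inj₁ j} b≢b' (_ , _ ▹ _ ▹ _ ▹ _ ▹ _ ▹ _ , short , _) with short (track (inj₁ i) (inj₁ j))
  ... | s≤s (s≤s (s≤s (s≤s ())))
  tips-geodesic F {inj₁ i} {inj₂ l} b≢b' (_ , up _ ▹ back _ ▹ out _ ▹ stop , _ , uniq) = uniq
  tips-geodesic F {inj₁ i} {inj₂ l} b≢b' (_ , _ ▹ _ ▹ _ ▹ _ ▹ _ , short , _) with short (track (inj₁ i) (inj₂ l))
  ... | s≤s (s≤s (s≤s ()))
  tips-geodesic F {inj₂ l} {inj₁ j} b≢b' (_ , back _ ▹ out _ ▹ down _ ▹ stop , _ , uniq) = uniq
  tips-geodesic F {inj₂ l} {inj₁ j} b≢b' (_ , _ ▹ _ ▹ _ ▹ _ ▹ _ , short , _) with short (track (inj₂ l) (inj₁ j))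
  ... | s≤s (s≤s (s≤s ()))
  tips-geodesic F {inj₂ l} {inj₂ l'} b≢b' (_ , stop , _) = contradiction refl b≢b'
  tips-geodesic F {inj₂ l} {inj₂ l'} b≢b' (_ , back _ ▹ out _ ▹ stop , _ , uniq) = uniq
  tips-geodesic F {inj₂ l} {inj₂ l'} b≢b' (_ , _ ▹ _ ▹ _ ▹ _ , short , _) with short (track (inj₂ l) (inj₂ l'))
  ... | s≤s (s≤s ())

  otherLeg : (b : Leg) → ∃[ b' ] b ≢ b'
  otherLeg (inj₂ zero)    = inj₂ (suc zero) , λ ()
  otherLeg (inj₁ _)       = inj₂ zero , λ ()
  otherLeg (inj₂ (suc _)) = inj₂ zero , λ ()

  -- Any two objects lie on a common spine: that of their home legs, or of their
  -- shared home leg and any other leg.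
  tips-separate : (home : C → Leg) (spine : Leg → Leg → List C) →
                  (∀ x b' → x ∈ spine (home x) b') → (∀ b x → x ∈ spine b (home x)) →
                  (φ : C → D) → (∀ {b b'} → b ≢ b' → Unique (map φ (spine b b'))) →
                  ∀ {x y} → φ x ≡ φ y → x ≡ y
  tips-separate home spine memˡ memʳ φ uniq {x} {y} eq with home x ≟ᴸ home y
  ... | no hx≢hy  = Unique-map⇒injective (uniq hx≢hy) (memˡ x (home y)) (memʳ (home x) y) eq
  ... | yes hx≡hy =
    let (b' , hx≢b') = otherLeg (home x) in
    Unique-map⇒injective (uniq hx≢b') (memˡ x b') (subst (λ b → y ∈ spine b b') (sym hx≡hy) (memˡ y b')) eq

  cutHome : Cut → Leg
  -- The hub lies on every spine, so any leg can be its home.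
  cutHome zero    = inj₂ zero
  cutHome (suc i) = inj₁ i

  itemHome : Item → Leg
  itemHome (inj₁ x)        = cutHome x
  itemHome (inj₂ (inj₁ b)) = b
  itemHome (inj₂ (inj₂ i)) = inj₁ i

  joint : Leg → List Cut
  joint (inj₁ i) = suc i ∷ []
  joint (inj₂ l) = []

  cutSpine : Leg → Leg → List Cut
  cutSpine b b' = joint b ++ zero ∷ joint b'

  ascent descent : Leg → List Edge
  ascent (inj₁ i) = inj₂ i ∷ inj₁ (inj₁ i) ∷ []
  ascent (inj₂ l) = inj₁ (inj₂ l) ∷ []
  descent (inj₁ i) = inj₁ (inj₁ i) ∷ inj₂ i ∷ []
  descent (inj₂ l) = inj₁ (inj₂ l) ∷ []

  -- Edges come before cut vertices, in the order in which `colours` lists them along `track`.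
  itemSpine : Leg → Leg → List Item
  itemSpine b b' = map inj₂ (ascent b ++ descent b') ++ map inj₁ (cutSpine b b')

  cut∈ˡ : ∀ x b' → x ∈ cutSpine (cutHome x) b'
  cut∈ˡ zero    b' = here refl
  cut∈ˡ (suc i) b' = here refl

  cut∈ʳ : ∀ b x → x ∈ cutSpine b (cutHome x)
  cut∈ʳ b zero    = ∈-++⁺ʳ (joint b) (here refl)
  cut∈ʳ b (suc i) = ∈-++⁺ʳ (joint b) (there (here refl))

  edge∈ˡ : ∀ e b' → e ∈ ascent (itemHome (inj₂ e)) ++ descent b'
  edge∈ˡ (inj₁ (inj₁ i)) b' = there (here refl)
  edge∈ˡ (inj₁ (inj₂ l)) b' = here refl
  edge∈ˡ (inj₂ i)        b' = here refl

  edge∈ʳ : ∀ b e → e ∈ ascent b ++ descent (itemHome (inj₂ e))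
  edge∈ʳ b (inj₁ (inj₁ i)) = ∈-++⁺ʳ (ascent b) (here refl)
  edge∈ʳ b (inj₁ (inj₂ l)) = ∈-++⁺ʳ (ascent b) (here refl)
  edge∈ʳ b (inj₂ i)        = ∈-++⁺ʳ (ascent b) (there (here refl))

  item∈ˡ : ∀ x b' → x ∈ itemSpine (itemHome x) b'
  item∈ˡ (inj₁ x) b' = ∈-++⁺ʳ _ (∈-map⁺ inj₁ (cut∈ˡ x b'))
  item∈ˡ (inj₂ e) b' = ∈-++⁺ˡ (∈-map⁺ inj₂ (edge∈ˡ e b'))

  item∈ʳ : ∀ b x → x ∈ itemSpine b (itemHome x)
  item∈ʳ b (inj₁ x) = ∈-++⁺ʳ (map inj₂ (ascent b ++ descent (cutHome x))) (∈-map⁺ inj₁ (cut∈ʳ b x))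
  item∈ʳ b (inj₂ e) = ∈-++⁺ˡ (∈-map⁺ inj₂ (edge∈ʳ b e))

  inner-track : ∀ b b' → inner (track b b') ≡ map cutVertex (cutSpine b b')
  inner-track (inj₁ _) (inj₁ _) = refl
  inner-track (inj₁ _) (inj₂ _) = refl
  inner-track (inj₂ _) (inj₁ _) = refl
  inner-track (inj₂ _) (inj₂ _) = refl

  ¬hasSRVC : ∀ j → j < suc T → ¬ HasSRVC graph j
  ¬hasSRVC j j<t srvc@(f , _) = <⇒≱ j<t (injective⇒≤
    (tips-separate cutHome cutSpine cut∈ˡ cut∈ʳ (h ∘ cutVertex) λ {b} {b'} b≢b' →
      subst Unique (trans (cong (map h) (inner-track b b')) (sym (map-∘ (cutSpine b b'))))
        (tips-geodesic (map h ∘ inner) b≢b' (viewSRVC srvc (tip b) (tip b')))))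
    where
    h : Vertex → Fin j
    h = f ∘ Inverse.to Vertex-code

  -- Any two items lie on the track between some two tips, so a strong total rainbow colouring is
  -- injective on all `strc` items.
  ¬hasSTRC : ∀ j → j < strc → ¬ HasSTRC graph j
  ¬hasSTRC j j<k strc@(f , c , _) = <⇒≱ j<k (injective⇒≤ {f = φ ∘ Inverse.from Item-code}
    (Injection.injective (↔⇒↣ (↔-sym Item-code)) ∘
      tips-separate itemHome itemSpine item∈ˡ item∈ʳ φ λ {b} {b'} b≢b' →
        subst Unique (φ-track b b') (tips-geodesic (colours ce h) b≢b' (viewSTRC strc (tip b) (tip b')))))
    where
    h : Vertex → Fin j
    h = f ∘ Inverse.to Vertex-code

    ce : ∀ {a b} → R a b → Fin j
    ce = pullEdge c

    φ : Item → Fin j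
    φ (inj₁ x)        = h (cutVertex x)
    φ (inj₂ (inj₁ b)) = ce (out b)
    φ (inj₂ (inj₂ i)) = ce (down i)

    -- `φ` reads each edge away from the hub, while the first half of a track runs towards it;
    -- symmetry of the colouring bridges the difference.
    φ-track : ∀ b b' → colours ce h (track b b') ≡ map φ (itemSpine b b')
    φ-track (inj₁ i) (inj₁ j) =
      cong₂ _∷_ (pullEdge-sym c (up i) (down i)) (cong₂ _∷_ (pullEdge-sym c (back (inj₁ i)) (out (inj₁ i))) refl)
    φ-track (inj₁ i) (inj₂ l) =
      cong₂ _∷_ (pullEdge-sym c (up i) (down i)) (cong₂ _∷_ (pullEdge-sym c (back (inj₁ i)) (out (inj₁ i))) refl)
    φ-track (inj₂ l) (inj₁ j) = cong₂ _∷_ (pullEdge-sym c (back (inj₂ l)) (out (inj₂ l))) refl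
    φ-track (inj₂ l) (inj₂ k) = cong₂ _∷_ (pullEdge-sym c (back (inj₂ l)) (out (inj₂ l))) refl

  notComplete : ¬ Complete graph
  notComplete = ¬complete {knee (inj₂ zero)} {knee (inj₂ (suc zero))} (λ ()) (λ ())

strc-large-srvc≡t : ∀ s t → 1 ≤ t → t < s → ∃[ G ] (Connected G × (∃[ k ] (Strc G k × s ≤ k)) × Srvc G t)
-- With `s` written as `2 + L`, the `s` short legs alone contribute `s` edges to strc; the hub and
-- the `T` inner knees are the `t` cut vertices.
strc-large-srvc≡t (suc (suc L)) (suc T) _ _ =
  graph , strc⇒connected hasSTRC ,
  (strc , (hasSTRC , ¬hasSTRC) , ≤-trans (m≤n+m (2 + L) T) (≤-trans (m≤m+n _ T) (m≤n+m _ (suc T)))) ,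
  inj₂ (notComplete , hasSRVC , ¬hasSRVC)
  where open Spider T L
strc-large-srvc≡t (suc zero) (suc T) _ (s≤s ())

theorem4p2 : (∀ m → ∃[ G ] (Connected G × m ≤ n G × Strc G 3 × Src G 3))
    × (∀ s → 13 ≤ s → ∃[ G ] (Connected G × Strc G s × Srvc G s))
    × (∀ s t → 1 ≤ t → t < s →
    ∃[ G ] (Connected G × (∃[ k ] (Strc G k × s ≤ k)) × Srvc G t))
theorem4p2 = arbitrarily-large-strc≡src≡3 , strc≡srvc≡s , strc-large-srvc≡t
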